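{- If $G$ and $G'$ are non-isomorphic graphs both of order $n$, then $\mathrm{D}(G,G')\le (n+3)/2$.
   Context: Graphs are finite, undirected and loopless; the order of a graph is its number of vertices. A graph is regarded as a structure with a single irreflexive symmetric binary predicate $E$ (adjacency). First order formulas use the predicate symbols $E$ and $=$ and the connectives $\neg,\wedge,\vee$; quantifiers range over vertices. A closed formula $\Phi$ distinguishes $G$ from $G'$ if $\Phi$ is true on $G$ and false on $G'$. The quantifier rank of $\Phi$ is the maximum number of nested quantifiers in $\Phi$. For non-isomorphic $G,G'$, $\mathrm{D}(G,G')$ denotes the minimum quantifier rank of a formula distinguishing $G$ from $G'$. -}

module Defs where

open import Level using (0ℓ)
open import Data.Nat using (ℕ; zero; suc; _⊔_; _≤_)
open import Data.Fin using (Fin)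
open import Data.Fin.Permutation using (Permutation; _⟨$⟩ʳ_)
open import Data.Vec using (Vec; []; _∷_; lookup)
open import Data.Product using (Σ; _×_; ∃-syntax)
open import Data.Sum using (_⊎_)
open import Function.Bundles using (_⇔_)
open import Relation.Binary using (Rel; Decidable; Symmetric; Irreflexive)
open import Relation.Binary.PropositionalEquality using (_≡_)
open import Relation.Nullary using (¬_)

-- Decidability of adjacency makes satisfaction over a finite graph decidable,
-- so the constructive reading of formulas below agrees with the classical one.
record Graph (n : ℕ) : Set₁ where
  field
    E        : Rel (Fin n) 0ℓ
    E?       : Decidable E
    E-sym    : Symmetric E
    E-irrefl : Irreflexive _≡_ E

infix 4 _≅_

_≅_ : ∀ {m n} → Graph m → Graph n → Set
_≅_ {m} {n} G H =
  Σ (Permutation m n) λ π →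
    ∀ u v → Graph.E G u v ⇔ Graph.E H (π ⟨$⟩ʳ u) (π ⟨$⟩ʳ v)

infix  8 _≐_
infix  7 ¬′_
infixr 6 _∧′_
infixr 5 _∨′_

-- Formulas with free variables among k de Bruijn indices; index zero refers
-- to the innermost quantifier.
data Formula (k : ℕ) : Set where
  adj  : (x y : Fin k) → Formula k
  _≐_  : (x y : Fin k) → Formula k
  ¬′_  : Formula k → Formula k
  _∧′_ : (φ ψ : Formula k) → Formula k
  _∨′_ : (φ ψ : Formula k) → Formula k
  ∃′   : Formula (suc k) → Formula k
  ∀′   : Formula (suc k) → Formula k

Sentence : Set
Sentence = Formula zero

rank : ∀ {k} → Formula k → ℕ
rank (adj x y) = 0
rank (x ≐ y)   = 0
rank (¬′ φ)    = rank φ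
rank (φ ∧′ ψ)  = rank φ ⊔ rank ψ
rank (φ ∨′ ψ)  = rank φ ⊔ rank ψ
rank (∃′ φ)    = suc (rank φ)
rank (∀′ φ)    = suc (rank φ)

Sat : ∀ {n k} → Graph n → Vec (Fin n) k → Formula k → Set
Sat G ρ (adj x y) = Graph.E G (lookup ρ x) (lookup ρ y)
Sat G ρ (x ≐ y)   = lookup ρ x ≡ lookup ρ y
Sat G ρ (¬′ φ)    = ¬ Sat G ρ φ
Sat G ρ (φ ∧′ ψ)  = Sat G ρ φ × Sat G ρ ψ
Sat G ρ (φ ∨′ ψ)  = Sat G ρ φ ⊎ Sat G ρ ψ
Sat G ρ (∃′ φ)    = ∃[ v ] Sat G (v ∷ ρ) φ
Sat G ρ (∀′ φ)    = ∀ v → Sat G (v ∷ ρ) φ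

infix 4 _⊨_

_⊨_ : ∀ {n} → Graph n → Sentence → Set
G ⊨ Φ = Sat G [] Φ

Distinguishes : ∀ {m n} → Sentence → Graph m → Graph n → Set
Distinguishes Φ G H = G ⊨ Φ × ¬ (H ⊨ Φ)

-- The minimum exists only when some sentence distinguishes G from H, so D is a
-- relation: D[ G , H ]≡ d says that the minimum exists and equals d.
record D[_,_]≡_ {m n} (G : Graph m) (H : Graph n) (d : ℕ) : Set where
  field
    attained : ∃[ Φ ] (Distinguishes Φ G H × rank Φ ≡ d)
    minimal  : ∀ Φ → Distinguishes Φ G H → d ≤ rank Φ

{-# OPTIONS --safe #-}

-- Suppose Duplicator survives ⌊(n+3)/2⌋ rounds of the Ehrenfeucht–Fraïssé game. Spoiler
-- first selects vertices X in G, as long as each of them increases the number of vertex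
-- types over X (equality and adjacency to X) by at least 2; hence there are at least
-- 2|X| + 1 types, so 2|X| + 1 ≤ n, and two rounds remain. When no such vertex is left,
-- adjacency between vertices with twins (other vertices of the same type) depends only on
-- their types. Two rounds now show that a bijection preserving types and adjacency to the
-- twinless vertices is an isomorphism. If there is none, some refined class D₁ is smaller
-- in G than its counterpart in G′, and some D₂ is larger in G. Say |D₁| ≤ |D₂′|, where D₂′
-- is the counterpart of D₂. Spoiler selects |D₁| + 1 vertices of D₁′. Some answer leaves
-- D₁, which a last round exposes; replacing the representatives of two types by D₁ and D₂
-- in a count of the vertices shows that there are enough rounds. If |D₁| > |D₂′|, the same
-- argument applies with the graphs exchanged.
module Submission where

open import Defs
open import Data.Nat using (ℕ; _+_; _*_; _≤_)
open import Data.Product using (_×_; ∃-syntax)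
open import Relation.Nullary using (¬_)

open import Data.Nat using (zero; suc; _∸_; _<_; z≤n; s≤s; s≤s⁻¹; ⌊_/2⌋; ⌈_/2⌉)
open import Data.Nat.Tactic.RingSolver using (solve-∀)
import Data.Nat.Properties as ℕ
open import Algebra.Properties.CommutativeSemigroup ℕ.+-commutativeSemigroup using (x∙yz≈y∙xz)
open import Data.Bool using (Bool; not; _∧_)
import Data.Bool.Properties as Bool
open import Data.Empty using (⊥; ⊥-elim)
import Data.Fin as Fin
open import Data.Fin using (Fin; zero; suc)
open import Data.Fin.Permutation as Permutation using (_⟨$⟩ʳ_; _∘ₚ_; cast-id)
import Data.Fin.Properties as Fin
open import Data.List as List using (List; []; _∷_; _++_; length; filter; allFin)
open import Data.List.Membership.Propositional using (_∈_; _∉_)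
open import Data.List.Membership.Propositional.Properties
  using (∈-lookup; ∈-filter⁺; ∈-filter⁻; ∈-allFin; ∈-∃++)
import Data.List.Membership.Setoid.Properties as Membershipₛ
import Data.List.Properties as List
import Data.List.Relation.Binary.Permutation.Homogeneous as Homogeneous
open import Data.List.Relation.Binary.Permutation.Propositional
  using (_↭_; ↭-refl; ↭-sym; ↭-trans; prep; ↭⇒↭ₛ)
open import Data.List.Relation.Binary.Permutation.Propositional.Properties
  using (shift; filter-↭; ↭-length)
import Data.List.Relation.Binary.Permutation.Setoid.Properties as Permutationₛ
open import Data.List.Relation.Unary.All as All using (All; []; _∷_)
import Data.List.Relation.Unary.All.Properties as All
open import Data.List.Relation.Unary.AllPairs as AllPairs using (AllPairs; []; _∷_)
import Data.List.Relation.Unary.AllPairs.Properties as AllPairs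
open import Data.List.Relation.Unary.Any as Any using (here; there)
open import Data.List.Relation.Unary.Unique.Propositional using (Unique)
import Data.List.Relation.Unary.Unique.Propositional.Properties as Unique
open import Data.Product using (_,_; proj₁; proj₂; map₂)
import Data.Product.Properties as Product
open import Data.Sum using (_⊎_; inj₁; inj₂; [_,_]′)
open import Data.Vec as Vec using (Vec; []; _∷_; lookup)
import Data.Vec.Properties as Vec
open import Function using (_∘_)
open import Function.Bundles using (_⇔_; mk⇔; Equivalence; Injection)
open import Function.Properties.Inverse using (↔⇒↣)
open import Relation.Binary using (DecidableEquality)
open import Relation.Binary.PropositionalEquality
  using (_≡_; _≢_; refl; sym; trans; cong; cong₂; subst; subst₂; setoid; module ≡-Reasoning)
open import Relation.Nullary using (Dec; yes; no; does; contradiction)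
open import Relation.Nullary.Decidable using (_×-dec_; ¬?; map′; dec-false; does-⇔; decidable-stable)
open import Relation.Unary using () renaming (Decidable to Decidable₁)
open Equivalence using (to; from)

-- Equality and adjacency as booleans

does-≡⇒⇔ : ∀ {a b} {A : Set a} {B : Set b} (a? : Dec A) (b? : Dec B) →
  does a? ≡ does b? → A ⇔ B
does-≡⇒⇔ (yes a) (yes b) _ = mk⇔ (λ _ → b) (λ _ → a)
does-≡⇒⇔ (no ¬a) (no ¬b) _ = mk⇔ (λ a → contradiction a ¬a) (λ b → contradiction b ¬b)

private variable
  m n k l : ℕ

-- As booleans, the atomic facts about a pair are compared across two graphs by one decidable
-- equation.
link : Graph n → Fin n → Fin n → Bool × Bool
link G u v = does (u Fin.≟ v) , does (Graph.E? G u v)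

link-sym : ∀ (G : Graph n) u v → link G u v ≡ link G v u
link-sym G u v = cong₂ _,_
  (does-⇔ (mk⇔ sym sym) (u Fin.≟ v) (v Fin.≟ u))
  (does-⇔ (mk⇔ (Graph.E-sym G) (Graph.E-sym G)) (Graph.E? G u v) (Graph.E? G v u))

link-refl : ∀ (G : Graph m) (H : Graph n) u v → link G u u ≡ link H v v
link-refl G H u v = cong₂ _,_
  (does-⇔ (mk⇔ (λ _ → refl) (λ _ → refl)) (u Fin.≟ u) (v Fin.≟ v))
  (does-⇔ (mk⇔ (⊥-elim ∘ Graph.E-irrefl G refl) (⊥-elim ∘ Graph.E-irrefl H refl))
    (Graph.E? G u u) (Graph.E? H v v))

infix 4 _≟²_
_≟²_ : (x y : Bool × Bool) → Dec (x ≡ y)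
_≟²_ = Product.≡-dec Bool._≟_ Bool._≟_

module _ (G : Graph m) (H : Graph n) {u v : Fin m} {u′ v′ : Fin n} where

  link⇒≡ : link G u v ≡ link H u′ v′ → u ≡ v ⇔ u′ ≡ v′
  link⇒≡ eq = does-≡⇒⇔ (u Fin.≟ v) (u′ Fin.≟ v′) (cong proj₁ eq)

  link⇒E : link G u v ≡ link H u′ v′ → Graph.E G u v ⇔ Graph.E H u′ v′
  link⇒E eq = does-≡⇒⇔ (Graph.E? G u v) (Graph.E? H u′ v′) (cong proj₂ eq)

-- Ehrenfeucht–Fraïssé games

module _ (G : Graph m) (H : Graph n) where

  PartialIso : Vec (Fin m) k → Vec (Fin n) k → Set
  PartialIso ρ ρ′ = ∀ i j →
    link G (lookup ρ i) (lookup ρ j) ≡ link H (lookup ρ′ i) (lookup ρ′ j)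

  -- Dup r ρ ρ′: Duplicator wins from the position (ρ , ρ′) with r rounds left.
  data Dup {k} : ℕ → Vec (Fin m) k → Vec (Fin n) k → Set where
    end  : ∀ {ρ ρ′} → PartialIso ρ ρ′ → Dup zero ρ ρ′
    move : ∀ {r ρ ρ′} → PartialIso ρ ρ′ →
      (∀ v  → ∃[ v′ ] Dup r (v ∷ ρ) (v′ ∷ ρ′)) →
      (∀ v′ → ∃[ v ]  Dup r (v ∷ ρ) (v′ ∷ ρ′)) → Dup (suc r) ρ ρ′

  partialIso? : (ρ : Vec (Fin m) k) (ρ′ : Vec (Fin n) k) → Dec (PartialIso ρ ρ′)
  partialIso? ρ ρ′ = Fin.all? λ i → Fin.all? λ j → _ ≟² _

  dup⇒partialIso : ∀ {r} {ρ : Vec (Fin m) k} {ρ′} → Dup r ρ ρ′ → PartialIso ρ ρ′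
  dup⇒partialIso (end p)      = p
  dup⇒partialIso (move p _ _) = p

  forth : ∀ {r} {ρ : Vec (Fin m) k} {ρ′} → Dup (suc r) ρ ρ′ →
    ∀ v → ∃[ v′ ] Dup r (v ∷ ρ) (v′ ∷ ρ′)
  forth (move _ f _) = f

  back : ∀ {r} {ρ : Vec (Fin m) k} {ρ′} → Dup (suc r) ρ ρ′ →
    ∀ v′ → ∃[ v ] Dup r (v ∷ ρ) (v′ ∷ ρ′)
  back (move _ _ b) = b

  dup? : ∀ r (ρ : Vec (Fin m) k) (ρ′ : Vec (Fin n) k) → Dec (Dup r ρ ρ′)
  dup? zero    ρ ρ′ = map′ end dup⇒partialIso (partialIso? ρ ρ′)
  dup? (suc r) ρ ρ′ = map′ (λ (p , f , b) → move p f b) (λ d → dup⇒partialIso d , forth d , back d)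
    (partialIso? ρ ρ′
      ×-dec Fin.all? (λ v  → Fin.any? λ v′ → dup? r (v ∷ ρ) (v′ ∷ ρ′))
      ×-dec Fin.all? (λ v′ → Fin.any? λ v  → dup? r (v ∷ ρ) (v′ ∷ ρ′)))

  dup-≤ : ∀ {q r} {ρ : Vec (Fin m) k} {ρ′} → q ≤ r → Dup r ρ ρ′ → Dup q ρ ρ′
  dup-≤ z≤n d = end (dup⇒partialIso d)
  dup-≤ (s≤s q≤r) (move p f b) =
    move p (λ v → map₂ (dup-≤ q≤r) (f v)) (λ v′ → map₂ (dup-≤ q≤r) (b v′))

  partialIso-restrict : ∀ {ρ : Vec (Fin m) k} {ρ′} {σ : Vec (Fin m) l} {σ′} (f : Fin l → Fin k) →
    (∀ i → lookup σ i ≡ lookup ρ (f i)) → (∀ i → lookup σ′ i ≡ lookup ρ′ (f i)) →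
    PartialIso ρ ρ′ → PartialIso σ σ′
  partialIso-restrict f eq eq′ p i j rewrite eq i | eq j | eq′ i | eq′ j = p (f i) (f j)

  -- A winning strategy survives forgetting or reordering earlier moves; `f⁺` keeps each new vertex
  -- in front.
  dup-restrict : ∀ {r} {ρ : Vec (Fin m) k} {ρ′} {σ : Vec (Fin m) l} {σ′} (f : Fin l → Fin k) →
    (∀ i → lookup σ i ≡ lookup ρ (f i)) → (∀ i → lookup σ′ i ≡ lookup ρ′ (f i)) →
    Dup r ρ ρ′ → Dup r σ σ′
  dup-restrict {ρ = ρ} {ρ′} {σ} {σ′} f eq eq′ (end p) =
    end (partialIso-restrict {ρ = ρ} {ρ′} {σ} {σ′} f eq eq′ p)
  dup-restrict {ρ = ρ} {ρ′} {σ} {σ′} f eq eq′ (move p fo ba) =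
    move (partialIso-restrict {ρ = ρ} {ρ′} {σ} {σ′} f eq eq′ p)
      (λ v → map₂ step (fo v)) (λ v′ → map₂ step (ba v′))
    where
    f⁺ : Fin (suc _) → Fin (suc _)
    f⁺ zero    = zero
    f⁺ (suc i) = suc (f i)
    step : ∀ {r v v′} → Dup r (v ∷ ρ) (v′ ∷ ρ′) → Dup r (v ∷ σ) (v′ ∷ σ′)
    step = dup-restrict f⁺ (λ { zero → refl ; (suc i) → eq i }) (λ { zero → refl ; (suc i) → eq′ i })

  -- A quantifier costs one round: Duplicator's answer carries a witness, or an instance, over to
  -- the other graph.
  dup⇒Sat⇔ : ∀ {r} {ρ : Vec (Fin m) k} {ρ′} (φ : Formula k) → rank φ ≤ r → Dup r ρ ρ′ →
    Sat G ρ φ ⇔ Sat H ρ′ φ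
  dup⇒Sat⇔ (adj x y) _ d = link⇒E G H (dup⇒partialIso d x y)
  dup⇒Sat⇔ (x ≐ y)   _ d = link⇒≡ G H (dup⇒partialIso d x y)
  dup⇒Sat⇔ (¬′ φ)    φ≤ d = mk⇔ (_∘ from ih) (_∘ to ih)
    where ih = dup⇒Sat⇔ φ φ≤ d
  dup⇒Sat⇔ (φ ∧′ ψ)  φψ≤ d = mk⇔
    (λ (a , b) → to ihφ a , to ihψ b) (λ (a , b) → from ihφ a , from ihψ b)
    where
    ihφ = dup⇒Sat⇔ φ (ℕ.m⊔n≤o⇒m≤o _ _ φψ≤) d
    ihψ = dup⇒Sat⇔ ψ (ℕ.m⊔n≤o⇒n≤o _ _ φψ≤) d
  dup⇒Sat⇔ (φ ∨′ ψ)  φψ≤ d = mk⇔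
    [ inj₁ ∘ to ihφ , inj₂ ∘ to ihψ ]′ [ inj₁ ∘ from ihφ , inj₂ ∘ from ihψ ]′
    where
    ihφ = dup⇒Sat⇔ φ (ℕ.m⊔n≤o⇒m≤o _ _ φψ≤) d
    ihψ = dup⇒Sat⇔ ψ (ℕ.m⊔n≤o⇒n≤o _ _ φψ≤) d
  dup⇒Sat⇔ (∃′ φ) (s≤s φ≤) (move _ f b) = mk⇔
    (λ (v , s) → let v′ , d = f v in v′ , to (dup⇒Sat⇔ φ φ≤ d) s)
    (λ (v′ , s) → let v , d = b v′ in v , from (dup⇒Sat⇔ φ φ≤ d) s)
  dup⇒Sat⇔ (∀′ φ) (s≤s φ≤) (move _ f b) = mk⇔
    (λ s v′ → let v , d = b v′ in to (dup⇒Sat⇔ φ φ≤ d) (s v))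
    (λ s v → let v′ , d = f v in from (dup⇒Sat⇔ φ φ≤ d) (s v′))

-- Separating formulas and the minimum rank

⊤′ ⊥′ : Formula (suc k)
⊤′ = zero ≐ zero
⊥′ = ¬′ ⊤′

-- The syntax has no truth constants, so the empty cases need a variable. Below a quantifier there
-- is always one.
⋀ ⋁ : (Fin n → Formula (suc k)) → Formula (suc k)
⋀ {zero}  φ = ⊤′
⋀ {suc n} φ = φ zero ∧′ ⋀ (φ ∘ suc)
⋁ {zero}  φ = ⊥′
⋁ {suc n} φ = φ zero ∨′ ⋁ (φ ∘ suc)

rank-⋀ : ∀ {r} (φ : Fin n → Formula (suc k)) → (∀ i → rank (φ i) ≤ r) → rank (⋀ φ) ≤ r
rank-⋀ {zero}  φ φ≤ = z≤n
rank-⋀ {suc n} φ φ≤ = ℕ.⊔-lub (φ≤ zero) (rank-⋀ (φ ∘ suc) (φ≤ ∘ suc))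

rank-⋁ : ∀ {r} (φ : Fin n → Formula (suc k)) → (∀ i → rank (φ i) ≤ r) → rank (⋁ φ) ≤ r
rank-⋁ {zero}  φ φ≤ = z≤n
rank-⋁ {suc n} φ φ≤ = ℕ.⊔-lub (φ≤ zero) (rank-⋁ (φ ∘ suc) (φ≤ ∘ suc))

module _ (G : Graph m) {ρ : Vec (Fin m) (suc k)} where

  ⋀⁺ : (φ : Fin n → Formula (suc k)) → (∀ i → Sat G ρ (φ i)) → Sat G ρ (⋀ φ)
  ⋀⁺ {zero}  φ s = refl
  ⋀⁺ {suc n} φ s = s zero , ⋀⁺ (φ ∘ suc) (s ∘ suc)

  ⋀⁻ : (φ : Fin n → Formula (suc k)) → Sat G ρ (⋀ φ) → ∀ i → Sat G ρ (φ i)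
  ⋀⁻ φ (s , _) zero    = s
  ⋀⁻ φ (_ , s) (suc i) = ⋀⁻ (φ ∘ suc) s i

  ⋁⁺ : (φ : Fin n → Formula (suc k)) → ∀ i → Sat G ρ (φ i) → Sat G ρ (⋁ φ)
  ⋁⁺ φ zero    s = inj₁ s
  ⋁⁺ φ (suc i) s = inj₂ (⋁⁺ (φ ∘ suc) i s)

  ⋁⁻ : (φ : Fin n → Formula (suc k)) → Sat G ρ (⋁ φ) → ∃[ i ] Sat G ρ (φ i)
  ⋁⁻ {zero}  φ s        = contradiction refl s
  ⋁⁻ {suc n} φ (inj₁ s) = zero , s
  ⋁⁻ {suc n} φ (inj₂ s) = let i , t = ⋁⁻ (φ ∘ suc) s in suc i , t

module _ (G : Graph m) (H : Graph n) where

  Separated : ℕ → Vec (Fin m) k → Vec (Fin n) k → Set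
  Separated r ρ ρ′ = ∃[ φ ] (rank φ ≤ r × Sat G ρ φ × ¬ Sat H ρ′ φ)

  separate-atom : ∀ {r} {ρ : Vec (Fin m) k} {ρ′} φ → rank φ ≤ r →
    Dec (Sat G ρ φ) → Dec (Sat H ρ′ φ) → ¬ (Sat G ρ φ ⇔ Sat H ρ′ φ) → Separated r ρ ρ′
  separate-atom φ φ≤ (yes s) (no ¬t)  _  = φ , φ≤ , s , ¬t
  separate-atom φ φ≤ (no ¬s) (yes t)  _  = ¬′ φ , φ≤ , ¬s , λ ¬t → ¬t t
  separate-atom φ φ≤ (yes s) (yes t)  ¬⇔ = contradiction (mk⇔ (λ _ → t) (λ _ → s)) ¬⇔
  separate-atom φ φ≤ (no ¬s) (no ¬t)  ¬⇔ =
    contradiction (mk⇔ (λ s → contradiction s ¬s) (λ t → contradiction t ¬t)) ¬⇔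

  ¬partialIso⇒separated : ∀ {r} {ρ : Vec (Fin m) k} {ρ′} → ¬ PartialIso G H ρ ρ′ → Separated r ρ ρ′
  ¬partialIso⇒separated {r = r} {ρ} {ρ′} ¬p
    with i , ¬pᵢ ← Fin.¬∀⟶∃¬ _ _ (λ i → Fin.all? λ j → _ ≟² _) ¬p
    with j , ¬pᵢⱼ ← Fin.¬∀⟶∃¬ _ _ (λ j → _ ≟² _) ¬pᵢ
    with does (lookup ρ i Fin.≟ lookup ρ j) Bool.≟ does (lookup ρ′ i Fin.≟ lookup ρ′ j)
  ... | no ≢ = separate-atom (i ≐ j) z≤n (_ Fin.≟ _) (_ Fin.≟ _) (λ iff → ≢ (does-⇔ iff (_ Fin.≟ _) (_ Fin.≟ _)))
  ... | yes eq = separate-atom (adj i j) z≤n (Graph.E? G _ _) (Graph.E? H _ _)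
    (λ iff → ¬pᵢⱼ (cong₂ _,_ eq (does-⇔ iff (Graph.E? G _ _) (Graph.E? H _ _))))

  -- Spoiler's winning strategy becomes a formula: the quantifier is his move, and the formulas for
  -- the finitely many answers are combined below it.
  ¬dup⇒separated : ∀ r {ρ : Vec (Fin m) k} {ρ′} → ¬ Dup G H r ρ ρ′ → Separated r ρ ρ′
  ¬dup⇒separated zero ¬d = ¬partialIso⇒separated (¬d ∘ end)
  ¬dup⇒separated (suc r) {ρ} {ρ′} ¬d
    with partialIso? G H ρ ρ′
       | Fin.all? (λ v  → Fin.any? λ v′ → dup? G H r (v ∷ ρ) (v′ ∷ ρ′))
       | Fin.all? (λ v′ → Fin.any? λ v  → dup? G H r (v ∷ ρ) (v′ ∷ ρ′))
  ... | no ¬p | _     | _     = ¬partialIso⇒separated ¬p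
  ... | yes p | yes f | yes b = contradiction (move p f b) ¬d
  ... | yes _ | no ¬f | _     =
    let v , ¬∃ = Fin.¬∀⟶∃¬ _ _ (λ v → Fin.any? λ v′ → dup? G H r (v ∷ ρ) (v′ ∷ ρ′)) ¬f
        sep = λ v′ → ¬dup⇒separated r (¬∃ ∘ (v′ ,_))
        φ = proj₁ ∘ sep
    in ∃′ (⋀ φ) , s≤s (rank-⋀ φ (proj₁ ∘ proj₂ ∘ sep)) ,
       (v , ⋀⁺ G φ (proj₁ ∘ proj₂ ∘ proj₂ ∘ sep)) ,
       λ (v′ , s) → proj₂ (proj₂ (proj₂ (sep v′))) (⋀⁻ H φ s v′)
  -- A move in `H` is dual: every vertex of `G` satisfies some disjunct, while `v′` satisfies none.
  ... | yes _ | yes _ | no ¬b =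
    let v′ , ¬∃ = Fin.¬∀⟶∃¬ _ _ (λ v′ → Fin.any? λ v → dup? G H r (v ∷ ρ) (v′ ∷ ρ′)) ¬b
        sep = λ v → ¬dup⇒separated r (¬∃ ∘ (v ,_))
        φ = proj₁ ∘ sep
    in ∀′ (⋁ φ) , s≤s (rank-⋁ φ (proj₁ ∘ proj₂ ∘ sep)) ,
       (λ v → ⋁⁺ G φ v (proj₁ (proj₂ (proj₂ (sep v))))) ,
       λ s → let v , t = ⋁⁻ H φ (s v′) in proj₂ (proj₂ (proj₂ (sep v))) t

dup-sym : ∀ (G : Graph m) (H : Graph n) {r} {ρ : Vec (Fin m) k} {ρ′} → Dup G H r ρ ρ′ → Dup H G r ρ′ ρ
dup-sym G H (end p)      = end (λ i j → sym (p i j))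
dup-sym G H (move p f b) = move (λ i j → sym (p i j))
  (λ v → map₂ (dup-sym G H) (b v)) (λ v → map₂ (dup-sym G H) (f v))

least : ∀ {p} {P : ℕ → Set p} → Decidable₁ P → ∀ k → P k →
  ∃[ d ] (d ≤ k × P d × (∀ j → j < d → ¬ P j))
least P? zero    p = zero , z≤n , p , λ _ ()
least P? (suc k) p with P? zero
... | yes p₀ = zero , z≤n , p₀ , λ _ ()
... | no ¬p₀ with d , d≤k , q , below ← least (P? ∘ suc) k p
  = suc d , s≤s d≤k , q , λ { zero _ → ¬p₀ ; (suc j) (s≤s j<d) → below j j<d }

-- Take the least number `d` of rounds that Duplicator cannot survive. A sentence of smaller rank
-- distinguishes nothing, so the separating sentence has rank exactly `d`.
¬dup⇒D : ∀ (G : Graph m) (H : Graph n) k → ¬ Dup G H k [] [] → ∃[ d ] (D[ G , H ]≡ d × d ≤ k)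
¬dup⇒D G H k ¬dup
  with d , d≤k , ¬d , below ← least (λ j → ¬? (dup? G H j [] [])) k ¬dup
  with Φ , rank≤ , s , ¬s ← ¬dup⇒separated G H d ¬d
  = d , record
      { attained = Φ , (s , ¬s) , ℕ.≤-antisym rank≤ (minimal Φ (s , ¬s))
      ; minimal  = minimal
      } , d≤k
  where
  minimal : ∀ Φ → Distinguishes Φ G H → d ≤ rank Φ
  minimal Φ (s , ¬s) = ℕ.≮⇒≥ λ rank<d →
    let dup = decidable-stable (dup? G H (rank Φ) [] []) (below (rank Φ) rank<d)
    in ¬s (to (dup⇒Sat⇔ G H Φ ℕ.≤-refl dup) s)

-- Counting

lookup-injective : ∀ {a} {A : Set a} {xs : List A} → Unique xs →
  ∀ {i j} → List.lookup xs i ≡ List.lookup xs j → i ≡ j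
lookup-injective (_  ∷ _)   {zero}  {zero}  _  = refl
lookup-injective (x∉ ∷ _)   {zero}  {suc j} eq = contradiction eq (All.lookup x∉ (∈-lookup j))
lookup-injective (x∉ ∷ _)   {suc i} {zero}  eq = contradiction (sym eq) (All.lookup x∉ (∈-lookup i))
lookup-injective (_  ∷ xs!) {suc i} {suc j} eq = cong suc (lookup-injective xs! eq)

unique⇒length≤ : {xs : List (Fin n)} → Unique xs → length xs ≤ n
unique⇒length≤ xs! = Fin.injective⇒≤ (lookup-injective xs!)

-- Representatives of distinct values of `f`; the length of the list bounds the number of values
-- from below.
DistinctBy : ∀ {a b} {A : Set a} {B : Set b} → (A → B) → List A → Set _
DistinctBy f = AllPairs (λ x y → f x ≢ f y)

module _ {a b} {A : Set a} {B : Set b} (_≟_ : DecidableEquality B) (f : A → B) where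

  avoid : List B → List A → List A
  avoid []       xs = xs
  avoid (b ∷ bs) xs = filter (λ x → ¬? (f x ≟ b)) (avoid bs xs)

  avoid-distinct : ∀ bs {xs} → DistinctBy f xs → DistinctBy f (avoid bs xs)
  avoid-distinct []       xs! = xs!
  avoid-distinct (b ∷ bs) xs! = AllPairs.filter⁺ _ (avoid-distinct bs xs!)

  avoid-∉ : ∀ bs xs → All (λ x → f x ∉ bs) (avoid bs xs)
  avoid-∉ []       xs = All.tabulate λ _ ()
  avoid-∉ (b ∷ bs) xs = All.zipWith
    (λ { (≢b , _) (here eq) → ≢b eq ; (_ , ∉bs) (there ∈bs) → ∉bs ∈bs })
    (All.all-filter _ (avoid bs xs) , All.filter⁺ _ (avoid-∉ bs xs))

  length-filter-≢ : ∀ b {xs} → DistinctBy f xs → length xs ≤ suc (length (filter (λ x → ¬? (f x ≟ b)) xs))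
  length-filter-≢ b [] = z≤n
  length-filter-≢ b {x ∷ xs} (x∉ ∷ xs!) with f x ≟ b
  ... | yes refl = s≤s (ℕ.≤-reflexive (cong length (sym (List.filter-all _ (All.map (_∘ sym) x∉)))))
  ... | no  _    = s≤s (length-filter-≢ b xs!)

  length-avoid : ∀ bs {xs} → DistinctBy f xs → length xs ≤ length bs + length (avoid bs xs)
  length-avoid []       xs! = ℕ.≤-refl
  length-avoid (b ∷ bs) {xs} xs! = begin
    length xs                                     ≤⟨ length-avoid bs xs! ⟩
    length bs + length (avoid bs xs)              ≤⟨ ℕ.+-monoʳ-≤ (length bs) (length-filter-≢ b (avoid-distinct bs xs!)) ⟩
    length bs + suc (length (avoid (b ∷ bs) xs))  ≡⟨ ℕ.+-suc (length bs) _ ⟩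
    suc (length bs + length (avoid (b ∷ bs) xs))  ∎
    where open ℕ.≤-Reasoning

  -- At most one representative shares the value of `f` at `x`. It makes way for both `x` and `y`,
  -- which `g` tells apart.
  refine : ∀ {c} {C : Set c} (g : A → C) → (∀ {x y} → g x ≡ g y → f x ≡ f y) →
    ∀ {x y} → f x ≡ f y → g x ≢ g y → ∀ {xs} → DistinctBy f xs →
    ∃[ ys ] (DistinctBy g ys × length xs < length ys)
  refine g g⇒f {x} {y} fx≡fy gx≢gy {xs} xs! =
    x ∷ y ∷ avoid (f x ∷ []) xs ,
    (gx≢gy ∷ All.map (λ ∉ eq → ∉ (here (sym (g⇒f eq)))) new) ∷
    All.map (λ ∉ eq → ∉ (here (trans (sym (g⇒f eq)) (sym fx≡fy)))) new ∷
    AllPairs.map (_∘ g⇒f) (avoid-distinct (f x ∷ []) xs!) ,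
    s≤s (length-avoid (f x ∷ []) xs!)
    where new = avoid-∉ (f x ∷ []) xs

-- Dropping the representatives with values in `bs` costs at most `length bs`. The others are
-- distinct and disjoint from `ys`, so together they fit into `n` vertices.
crowd : ∀ {b} {B : Set b} (_≟_ : DecidableEquality B) (f : Fin n → B) bs {xs ys} →
  DistinctBy f xs → Unique ys → All (λ y → f y ∈ bs) ys → length xs + length ys ≤ length bs + n
crowd {n} _≟_ f bs {xs} {ys} xs! ys! ys∈ = begin
  length xs + length ys                ≤⟨ ℕ.+-monoˡ-≤ (length ys) (length-avoid _≟_ f bs xs!) ⟩
  length bs + length zs + length ys    ≡⟨ ℕ.+-assoc (length bs) _ _ ⟩
  length bs + (length zs + length ys)  ≡⟨ cong (length bs +_) (List.length-++ zs) ⟨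
  length bs + length (zs ++ ys)        ≤⟨ ℕ.+-monoʳ-≤ (length bs) (unique⇒length≤ zs++ys!) ⟩
  length bs + n                        ∎
  where
  open ℕ.≤-Reasoning
  zs = avoid _≟_ f bs xs
  zs++ys! : Unique (zs ++ ys)
  zs++ys! = AllPairs.++⁺
    (AllPairs.map (λ f≢ eq → f≢ (cong f eq)) (avoid-distinct _≟_ f bs xs!)) ys!
    (All.map (λ ∉bs → All.map (λ { ∈bs refl → ∉bs ∈bs }) ys∈) (avoid-∉ _≟_ f bs xs))

-- Multiplicities and matchings

module _ {b} {B : Set b} (_≟_ : DecidableEquality B) where

  count : B → List B → ℕ
  count c xs = length (filter (_≟ c) xs)

  count-↭ : ∀ c {xs ys} → xs ↭ ys → count c xs ≡ count c ys
  count-↭ c xs↭ys = ↭-length (filter-↭ (_≟ c) xs↭ys)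

  count-∷-< : ∀ x c {xs ys} → count c xs < count c ys → count c (x ∷ xs) < count c (x ∷ ys)
  count-∷-< x c lt with x ≟ c
  ... | yes _ = s≤s lt
  ... | no  _ = lt

  count-∉ : ∀ {x ys} → x ∉ ys → count x ys ≡ 0
  count-∉ {x} x∉ys =
    cong length (List.filter-none (_≟ x) (All.tabulate λ { y∈ys refl → x∉ys y∈ys }))

  count-∉-< : ∀ {x c xs ys} → x ∉ ys → count c xs < count c ys → count c (x ∷ xs) < count c ys
  count-∉-< {x} {c} x∉ys lt with x ≟ c
  ... | yes refl = contradiction (subst (_ <_) (count-∉ x∉ys) lt) λ ()
  ... | no  _    = lt

  extract : ∀ {x : B} {ys} → x ∈ ys → ∃[ ys′ ] (ys ↭ x ∷ ys′)
  extract {x} x∈ys with as , bs , refl ← ∈-∃++ x∈ys = as ++ bs , shift x as bs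

  count-<-extract : ∀ {x c xs ys ys′} → ys ↭ x ∷ ys′ →
    count c xs < count c ys′ → count c (x ∷ xs) < count c ys
  count-<-extract {x} {c} p lt = subst (_ <_) (sym (count-↭ c p)) (count-∷-< x c lt)

  count->-extract : ∀ {x c xs ys ys′} → ys ↭ x ∷ ys′ →
    count c ys′ < count c xs → count c ys < count c (x ∷ xs)
  count->-extract {x} {c} p lt = subst (_< _) (sym (count-↭ c p)) (count-∷-< x c lt)

  open import Data.List.Membership.DecPropositional _≟_ using (_∈?_)

  length-<⇒count-< : ∀ xs ys → length xs < length ys → ∃[ c ] count c xs < count c ys
  length-<⇒count-< [] (y ∷ ys) _ =
    y , List.filter-some (_≟ y) (here refl)
  length-<⇒count-< (x ∷ xs) ys lt with x ∈? ys
  ... | no x∉ys = map₂ (count-∉-< x∉ys) (length-<⇒count-< xs ys (ℕ.<⇒≤ lt))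
  ... | yes x∈ys with ys′ , p ← extract x∈ys =
    map₂ (count-<-extract p) (length-<⇒count-< xs ys′ (s≤s⁻¹ (subst (_ <_) (↭-length p) lt)))

  -- Common elements cancel. An `x` absent from `ys` is itself too frequent, and the rest of the
  -- first list, being shorter than `ys`, has too few of some value.
  ↭-or-imbalance : ∀ xs ys → length xs ≡ length ys →
    xs ↭ ys ⊎ (∃[ c ] count c xs < count c ys) × (∃[ c ] count c ys < count c xs)
  ↭-or-imbalance [] [] _ = inj₁ ↭-refl
  ↭-or-imbalance (x ∷ xs) ys eq with x ∈? ys
  ... | no x∉ys = inj₂
    ( map₂ (count-∉-< x∉ys) (length-<⇒count-< xs ys (ℕ.≤-reflexive eq))
    , x , subst (_< _) (sym (count-∉ x∉ys)) (List.filter-some (_≟ x) (here refl)) )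
  ... | yes x∈ys with ys′ , p ← extract x∈ys
    with ↭-or-imbalance xs ys′ (ℕ.suc-injective (trans eq (↭-length p)))
  ... | inj₁ q = inj₁ (↭-trans (prep x q) (↭-sym p))
  ... | inj₂ (less , more) = inj₂ (map₂ (count-<-extract p) less , map₂ (count->-extract p) more)

  fibre : (Fin n → B) → B → List (Fin n)
  fibre δ c = filter (λ u → δ u ≟ c) (allFin _)

  fibre! : (δ : Fin n → B) → ∀ c → Unique (fibre δ c)
  fibre! {n} δ c = Unique.filter⁺ (λ u → δ u ≟ c) (Unique.allFin⁺ n)

  count-map : ∀ {a} {A : Set a} (f : A → B) c xs →
    count c (List.map f xs) ≡ length (filter (λ x → f x ≟ c) xs)
  count-map f c [] = refl
  count-map f c (x ∷ xs) with f x ≟ c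
  ... | yes _ = cong suc (count-map f c xs)
  ... | no  _ = count-map f c xs

  count-tabulate : (δ : Fin n → B) → ∀ c → count c (List.tabulate δ) ≡ length (fibre δ c)
  count-tabulate {n} δ c =
    trans (cong (count c) (sym (List.map-tabulate (λ i → i) δ))) (count-map δ c (allFin n))

  tabulate-↭⇒permutation : (δ δ′ : Fin n → B) → List.tabulate δ ↭ List.tabulate δ′ →
    ∃[ π ] (∀ u → δ u ≡ δ′ (π ⟨$⟩ʳ u))
  -- The list permutation acts on the indices of tabulated lists, whose lengths equal `n` only
  -- propositionally; hence the casts.
  tabulate-↭⇒permutation {n} δ δ′ p = cast-id (sym len) ∘ₚ σ ∘ₚ cast-id len′ , matches
    where
    len  = List.length-tabulate δ
    len′ = List.length-tabulate δ′
    σ = Homogeneous.onIndices (↭⇒↭ₛ p)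
    matches : ∀ u → δ u ≡ δ′ (cast-id len′ ⟨$⟩ʳ (σ ⟨$⟩ʳ (cast-id (sym len) ⟨$⟩ʳ u)))
    matches u = begin
      δ u                                                 ≡⟨ List.lookup-tabulate δ u ⟨
      List.lookup (List.tabulate δ) i                     ≡⟨ Permutationₛ.onIndices-lookup (setoid B) (↭⇒↭ₛ p) i ⟩
      List.lookup (List.tabulate δ′) j                    ≡⟨ cong (List.lookup (List.tabulate δ′)) (Fin.cast-involutive (sym len′) len′ j) ⟨
      List.lookup (List.tabulate δ′) (Fin.cast _ (Fin.cast len′ j)) ≡⟨ List.lookup-tabulate δ′ (Fin.cast len′ j) ⟩
      δ′ (Fin.cast len′ j)                                ∎
      where
      open ≡-Reasoning
      i = Fin.cast (sym len) u
      j = σ ⟨$⟩ʳ i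

  matching-or-imbalance : (δ δ′ : Fin n → B) →
    (∃[ π ] (∀ u → δ u ≡ δ′ (π ⟨$⟩ʳ u))) ⊎
    (∃[ c ] length (fibre δ c) < length (fibre δ′ c)) × (∃[ c ] length (fibre δ′ c) < length (fibre δ c))
  matching-or-imbalance δ δ′
    with ↭-or-imbalance (List.tabulate δ) (List.tabulate δ′)
           (trans (List.length-tabulate δ) (sym (List.length-tabulate δ′)))
  ... | inj₁ p = inj₁ (tabulate-↭⇒permutation δ δ′ p)
  ... | inj₂ ((c , lt) , (c′ , gt)) = inj₂
    ( (c  , subst₂ _<_ (count-tabulate δ c)   (count-tabulate δ′ c)  lt)
    , (c′ , subst₂ _<_ (count-tabulate δ′ c′) (count-tabulate δ c′)  gt) )

-- Types over a position

Type : ℕ → Set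
Type k = Vec (Bool × Bool) k

_≟ᵗ_ : DecidableEquality (Type k)
_≟ᵗ_ = Vec.≡-dec _≟²_

tp : Graph n → Vec (Fin n) k → Fin n → Type k
tp G ρ u = Vec.map (link G u) ρ

module _ (G : Graph m) (H : Graph n) where

  tp-cong : ∀ {ρ : Vec (Fin m) k} {ρ′} {u u′} →
    (∀ i → link G u (lookup ρ i) ≡ link H u′ (lookup ρ′ i)) → tp G ρ u ≡ tp H ρ′ u′
  tp-cong {ρ = []}    {[]}     eq = refl
  tp-cong {ρ = _ ∷ _} {_ ∷ _}  eq = cong₂ _∷_ (eq zero) (tp-cong (eq ∘ suc))

  dup⇒tp≡ : ∀ {r} {ρ : Vec (Fin m) k} {ρ′ u u′} → Dup G H r (u ∷ ρ) (u′ ∷ ρ′) → tp G ρ u ≡ tp H ρ′ u′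
  dup⇒tp≡ d = tp-cong (dup⇒partialIso G H d zero ∘ suc)

  dup-head : ∀ {r} {ρ : Vec (Fin m) k} {ρ′} {xs : Vec (Fin m) l} {xs′} i →
    Dup G H r (xs Vec.++ ρ) (xs′ Vec.++ ρ′) → Dup G H r (lookup xs i ∷ ρ) (lookup xs′ i ∷ ρ′)
  dup-head {k = k} {l = l} {ρ = ρ} {ρ′} {xs} {xs′} i = dup-restrict G H f
    (λ { zero → sym (Vec.lookup-++ˡ xs ρ i) ; (suc j) → sym (Vec.lookup-++ʳ xs ρ j) })
    (λ { zero → sym (Vec.lookup-++ˡ xs′ ρ′ i) ; (suc j) → sym (Vec.lookup-++ʳ xs′ ρ′ j) })
    where
    f : Fin (suc k) → Fin (l + k)
    f zero    = i Fin.↑ˡ k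
    f (suc j) = l Fin.↑ʳ j

  -- Spoiler plays `xs′` from its last entry to its first, since each new vertex joins the front of
  -- the position.
  back* : ∀ {r} {ρ : Vec (Fin m) k} {ρ′} (xs′ : Vec (Fin n) l) → Dup G H (l + r) ρ ρ′ →
    ∃[ xs ] Dup G H r (xs Vec.++ ρ) (xs′ Vec.++ ρ′)
  back* [] d = [] , d
  back* {l = suc l} {r = r} {ρ} {ρ′} (x′ ∷ xs′) d
    with xs , e ← back* {r = suc r} xs′ (subst (λ q → Dup G H q ρ ρ′) (sym (ℕ.+-suc l r)) d)
    with x , e′ ← back G H e x′
    = x ∷ xs , e′

-- Refined classes of unequal sizes

2[a+1+b] : ∀ a b → 2 * (a + suc b) ≡ 2 * a + 1 + (b + suc b)
2[a+1+b] = solve-∀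

-- For `e` = 0 this pays for `m₁` + 1 rounds. For `e` = 1 it makes an inequality between doubles
-- strict, which is worth one whole further round.
spare-rounds : ∀ e k r {m₁ m₂ l n} → 2 * k + 1 ≤ l → suc m₁ ≤ m₂ →
  l + (e + (m₁ + m₂)) ≤ 2 + n → 2 + n ≤ 2 * (k + r) → e + 2 * (k + suc m₁) ≤ 2 * (k + r)
spare-rounds e k r {m₁} {m₂} {l} {n} k≤ m₁<m₂ ≤n n≤ = begin
  e + 2 * (k + suc m₁)                ≡⟨ cong (e +_) (2[a+1+b] k m₁) ⟩
  e + (2 * k + 1 + (m₁ + suc m₁))     ≤⟨ ℕ.+-monoʳ-≤ e (ℕ.+-mono-≤ k≤ (ℕ.+-monoʳ-≤ m₁ m₁<m₂)) ⟩
  e + (l + (m₁ + m₂))                 ≡⟨ x∙yz≈y∙xz e l (m₁ + m₂) ⟩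
  l + (e + (m₁ + m₂))                 ≤⟨ ≤n ⟩
  2 + n                               ≤⟨ n≤ ⟩
  2 * (k + r)                         ∎
  where open ℕ.≤-Reasoning

-- Types over the position must agree even with no round left; comparing `ε` with `ε′` may take one
-- more round. The two together define the refined classes.
module _ (G H : Graph n) {C : Set} (_≟ᶜ_ : DecidableEquality C) {ρ ρ′ : Vec (Fin n) k}
  (ε ε′ : Fin n → C) (dup⇒ε≡ : ∀ {u u′} → Dup G H 1 (u ∷ ρ) (u′ ∷ ρ′) → ε u ≡ ε′ u′)
  where

  private
    infix 4 _≟ᵇ_
    _≟ᵇ_ : DecidableEquality (Type k × C)
    _≟ᵇ_ = Product.≡-dec _≟ᵗ_ _≟ᶜ_

    δ δ′ : Fin n → Type k × C
    δ  u = tp G ρ  u , ε u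
    δ′ u = tp H ρ′ u , ε′ u

    F F′ : Type k × C → List (Fin n)
    F  = fibre _≟ᵇ_ δ
    F′ = fibre _≟ᵇ_ δ′

    ∈F⇒ : ∀ {c u} → u ∈ F c → δ u ≡ c
    ∈F⇒ {c} = proj₂ ∘ ∈-filter⁻ (λ u → δ u ≟ᵇ c) {xs = allFin n}

  -- The counting bound just allows length (F c₁) + 1 moves. The last round, which exposes an
  -- answer e outside F c₁, comes from e itself being one more vertex to count or, when the
  -- types of c₁ and c₂ coincide, from D₁ and D₂ replacing only one representative.
  module Imbalance {r R c₁ c₂} (R! : DistinctBy (tp G ρ) R) (k≤R : 2 * k + 1 ≤ length R)
    (n≤ : 2 + n ≤ 2 * (k + r)) (d : Dup G H r ρ ρ′)
    (lt₁ : length (F c₁) < length (F′ c₁)) (lt₂ : length (F c₁) < length (F c₂))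
    where

    D₁ = F c₁
    D₂ = F c₂
    m₁ = length D₁

    c₁≢c₂ : c₁ ≢ c₂
    c₁≢c₂ refl = ℕ.<-irrefl refl lt₂

    D₁++D₂! : Unique (D₁ ++ D₂)
    D₁++D₂! = Unique.++⁺ (fibre! _≟ᵇ_ δ c₁) (fibre! _≟ᵇ_ δ c₂)
      λ (∈D₁ , ∈D₂) → c₁≢c₂ (trans (sym (∈F⇒ ∈D₁)) (∈F⇒ ∈D₂))

    D₁++D₂-types : All (λ u → tp G ρ u ∈ proj₁ c₁ ∷ proj₁ c₂ ∷ []) (D₁ ++ D₂)
    D₁++D₂-types = All.++⁺
      (All.tabulate λ ∈D₁ → here (cong proj₁ (∈F⇒ ∈D₁)))
      (All.tabulate λ ∈D₂ → there (here (cong proj₁ (∈F⇒ ∈D₂))))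

    len : length (D₁ ++ D₂) ≡ m₁ + length D₂
    len = List.length-++ D₁

    spare : suc m₁ ≤ r
    spare = ℕ.+-cancelˡ-≤ k _ _ (ℕ.*-cancelˡ-≤ 2 (spare-rounds 0 k r k≤R lt₂
      (subst (λ l → length R + l ≤ 2 + n) len (crowd _≟ᵗ_ (tp G ρ) _ R! D₁++D₂! D₁++D₂-types)) n≤))

    q = r ∸ suc m₁

    m₁+q≡r : suc m₁ + q ≡ r
    m₁+q≡r = ℕ.m+[n∸m]≡n spare

    pick : Fin (suc m₁) → Fin n
    pick i = List.lookup (F′ c₁) (Fin.inject≤ i lt₁)

    xs′ : Vec (Fin n) (suc m₁)
    xs′ = Vec.tabulate pick

    answer : ∃[ xs ] Dup G H q (xs Vec.++ ρ) (xs′ Vec.++ ρ′)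
    answer = back* G H xs′ (subst (λ q → Dup G H q ρ ρ′) (sym m₁+q≡r) d)

    xs = proj₁ answer

    δ′-xs′ : ∀ i → δ′ (lookup xs′ i) ≡ c₁
    δ′-xs′ i rewrite Vec.lookup∘tabulate pick i =
      proj₂ (∈-filter⁻ (λ u → δ′ u ≟ᵇ c₁) {xs = allFin n} (∈-lookup (Fin.inject≤ i lt₁)))

    xs′-injective : ∀ {i j} → lookup xs′ i ≡ lookup xs′ j → i ≡ j
    xs′-injective {i} {j} eq = Fin.inject≤-injective lt₁ lt₁ i j
      (lookup-injective (fibre! _≟ᵇ_ δ′ c₁)
        (trans (sym (Vec.lookup∘tabulate pick i)) (trans eq (Vec.lookup∘tabulate pick j))))

    xs-injective : ∀ {i j} → lookup xs i ≡ lookup xs j → i ≡ j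
    xs-injective {i} {j} eq = xs′-injective
      (subst₂ _≡_ (Vec.lookup-++ˡ xs′ ρ′ i) (Vec.lookup-++ˡ xs′ ρ′ j)
        (to (link⇒≡ G H (dup⇒partialIso G H (proj₂ answer) (i Fin.↑ˡ k) (j Fin.↑ˡ k)))
          (subst₂ _≡_ (sym (Vec.lookup-++ˡ xs ρ i)) (sym (Vec.lookup-++ˡ xs ρ j)) eq)))

    -- The `m₁` + 1 answers are distinct because the moves are, and `D₁` has only `m₁` places.
    ¬all : ¬ (∀ i → δ (lookup xs i) ≡ c₁)
    ¬all all = ℕ.1+n≰n (Fin.injective⇒≤ {f = Any.index ∘ ∈D₁} λ eq →
      xs-injective (Membershipₛ.index-injective (setoid _) (∈D₁ _) (∈D₁ _) eq))
      where
      ∈D₁ : ∀ i → lookup xs i ∈ D₁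
      ∈D₁ i = ∈-filter⁺ (λ u → δ u ≟ᵇ c₁) (∈-allFin _) (all i)

    module _ (i : Fin (suc m₁)) (δe≢c₁ : δ (lookup xs i) ≢ c₁) where
      e = lookup xs i

      -- The answer has the right type even with no round left, so it can be outside `D₁` only
      -- because of `ε`.
      tp-e : tp G ρ e ≡ proj₁ c₁
      tp-e = trans (dup⇒tp≡ G H (dup-head G H {xs = xs} {xs′} i (proj₂ answer))) (cong proj₁ (δ′-xs′ i))

      e∷D₁++D₂! : proj₁ c₁ ≢ proj₁ c₂ → Unique (e ∷ D₁ ++ D₂)
      e∷D₁++D₂! ≢ = All.++⁺ {xs = D₁}
        (All.tabulate λ { ∈D₁ refl → δe≢c₁ (∈F⇒ ∈D₁) })
        (All.tabulate λ { ∈D₂ refl → ≢ (trans (sym tp-e) (cong proj₁ (∈F⇒ ∈D₂))) }) ∷ D₁++D₂!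

      crowded : Dec (proj₁ c₁ ≡ proj₁ c₂) → length R + suc (length (D₁ ++ D₂)) ≤ 2 + n
      crowded (yes eq) = ℕ.≤-trans (ℕ.≤-reflexive (ℕ.+-suc (length R) (length (D₁ ++ D₂))))
        (s≤s (crowd _≟ᵗ_ (tp G ρ) (proj₁ c₁ ∷ []) R! D₁++D₂!
          (All.map (λ { (here p) → here p ; (there (here p)) → here (trans p (sym eq)) }) D₁++D₂-types)))
      crowded (no ≢) =
        crowd _≟ᵗ_ (tp G ρ) (proj₁ c₁ ∷ proj₁ c₂ ∷ []) R! (e∷D₁++D₂! ≢) (here tp-e ∷ D₁++D₂-types)

      1≤q : 1 ≤ q
      1≤q = ℕ.+-cancelˡ-≤ (suc m₁) _ _ (subst₂ _≤_ (ℕ.+-comm 1 (suc m₁)) (sym m₁+q≡r)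
        (ℕ.+-cancelˡ-< k _ _ (ℕ.*-cancelˡ-< 2 _ _ (spare-rounds 1 k r k≤R lt₂
          (subst (λ l → length R + suc l ≤ 2 + n) len (crowded (proj₁ c₁ ≟ᵗ proj₁ c₂))) n≤))))

      -- With one round left `ε` agrees as well, so `e` would belong to `D₁` after all.
      exposed : ⊥
      exposed = δe≢c₁ (trans (cong₂ _,_ tp-≡ (dup⇒ε≡ d₁)) (δ′-xs′ i))
        where
        d₁ = dup-≤ G H 1≤q (dup-head G H {xs = xs} {xs′} i (proj₂ answer))
        tp-≡ = dup⇒tp≡ G H d₁

    absurd : ⊥
    absurd = let i , ≢ = Fin.¬∀⟶∃¬ _ _ (λ i → δ (lookup xs i) ≟ᵇ c₁) ¬all in exposed i ≢

-- Twins and improving moves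

module _ (G : Graph n) (ρ : Vec (Fin n) k) where

  -- Vertices with a twin; all others are determined by their types.
  Multi : Fin n → Set
  Multi u = ∃[ v ] (v ≢ u × tp G ρ v ≡ tp G ρ u)

  multi? : ∀ u → Dec (Multi u)
  multi? u = Fin.any? λ v → ¬? (v Fin.≟ u) ×-dec (tp G ρ v ≟ᵗ tp G ρ u)

  ¬multi⇒≡ : ∀ {u v} → ¬ Multi u → tp G ρ v ≡ tp G ρ u → v ≡ u
  ¬multi⇒≡ {u} {v} ¬multi eq = decidable-stable (v Fin.≟ u) λ v≢u → ¬multi (v , v≢u , eq)

  multi-resp : ∀ {u v} → tp G ρ v ≡ tp G ρ u → Multi u → Multi v
  multi-resp {u} {v} eq (w , w≢u , eq′) with u Fin.≟ v
  ... | yes refl = w , w≢u , eq′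
  ... | no u≢v   = u , u≢v , sym eq

  Splitting : Fin n → Fin n → Fin n → Set
  Splitting u w₁ w₂ = w₁ ≢ u × w₂ ≢ u × tp G ρ w₁ ≡ tp G ρ w₂ × link G u w₁ ≢ link G u w₂

  Improvable : Set
  Improvable = ∃[ u ] (Multi u × ∃[ w₁ ] ∃[ w₂ ] Splitting u w₁ w₂)

  improvable? : Dec Improvable
  improvable? = Fin.any? λ u → multi? u ×-dec Fin.any? λ w₁ → Fin.any? λ w₂ →
    ¬? (w₁ Fin.≟ u) ×-dec ¬? (w₂ Fin.≟ u) ×-dec (tp G ρ w₁ ≟ᵗ tp G ρ w₂) ×-dec ¬? (link G u w₁ ≟² link G u w₂)

  -- Distinguishing u from its twins gives one more type, splitting w₁ from w₂ another one.
  improve : ∀ {u w₁ w₂ R} → Multi u → Splitting u w₁ w₂ → DistinctBy (tp G ρ) R →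
    ∃[ R′ ] (DistinctBy (tp G (u ∷ ρ)) R′ × 2 + length R ≤ length R′)
  improve {u} {w₁} {w₂} {R} (v , v≢u , tp-v) (w₁≢u , w₂≢u , tp-w , link≢) R! =
    let R₁ , R₁! , R<R₁  = refine _≟ᵗ_ (tp G ρ) g (cong proj₁) tp-v gv≢gu R!
        R₂ , R₂! , R₁<R₂ = refine (Product.≡-dec _≟ᵗ_ Bool._≟_) g (tp G (u ∷ ρ)) tp⇒g
          -- Both vertices differ from `u`, so `g` does not separate them yet and the second gain is
          -- a new one.
          (cong₂ _,_ tp-w (trans (dec-false (w₁ Fin.≟ u) w₁≢u) (sym (dec-false (w₂ Fin.≟ u) w₂≢u))))
          (λ eq → link≢ (trans (link-sym G u w₁) (trans (Vec.∷-injectiveˡ eq) (link-sym G w₂ u)))) R₁!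
    in R₂ , R₂! , ℕ.≤-trans (s≤s R<R₁) R₁<R₂
    where
    g : Fin n → Type k × Bool
    g w = tp G ρ w , does (w Fin.≟ u)
    gv≢gu : g v ≢ g u
    gv≢gu eq = v≢u (from (does-≡⇒⇔ (v Fin.≟ u) (u Fin.≟ u) (cong proj₂ eq)) refl)
    tp⇒g : ∀ {x y} → tp G (u ∷ ρ) x ≡ tp G (u ∷ ρ) y → g x ≡ g y
    tp⇒g eq = cong₂ _,_ (Vec.∷-injectiveʳ eq) (cong proj₁ (Vec.∷-injectiveˡ eq))

  -- Without an improving move, a vertex with a twin is linked alike to all other vertices of one
  -- type. So endpoints can be exchanged one at a time: `v` for `b`, then `u` for `a`.
  link-homogeneous : ¬ Improvable → ∀ {u v a b} → Multi u → Multi v →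
    tp G ρ a ≡ tp G ρ u → tp G ρ b ≡ tp G ρ v → a ≢ b → u ≢ v → link G u v ≡ link G a b
  link-homogeneous ¬imp {u} {v} {a} {b} mu mv tp-a tp-b a≢b u≢v = by-cases (b Fin.≟ u)
    where
    open ≡-Reasoning
    uniform : ∀ {u w₁ w₂} → Multi u → w₁ ≢ u → w₂ ≢ u → tp G ρ w₁ ≡ tp G ρ w₂ → link G u w₁ ≡ link G u w₂
    uniform {u} {w₁} {w₂} mu ≢₁ ≢₂ eq = decidable-stable (link G u w₁ ≟² link G u w₂)
      λ link≢ → ¬imp (u , mu , w₁ , w₂ , ≢₁ , ≢₂ , eq , link≢)
    by-cases : Dec (b ≡ u) → link G u v ≡ link G a b
    -- The intermediate pair would be a loop at `u`; but here `v` and `a` have the same type, and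
    -- one exchange suffices.
    by-cases (yes refl) = begin
      link G u v  ≡⟨ uniform mu (u≢v ∘ sym) a≢b (trans (sym tp-b) (sym tp-a)) ⟩
      link G u a  ≡⟨ link-sym G u a ⟩
      link G a u  ∎
    by-cases (no b≢u) = begin
      link G u v  ≡⟨ uniform mu (u≢v ∘ sym) b≢u (sym tp-b) ⟩
      link G u b  ≡⟨ link-sym G u b ⟩
      link G b u  ≡⟨ uniform (multi-resp tp-b mv) (b≢u ∘ sym) a≢b (sym tp-a) ⟩
      link G b a  ≡⟨ link-sym G b a ⟩
      link G a b  ∎

-- Positions without improving moves

module Maximal (G H : Graph n) {ρ ρ′ : Vec (Fin n) k} {r}
  (d : Dup G H (2 + r) ρ ρ′) (¬imp : ¬ Improvable G ρ) where

  φ : Fin n → Fin n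
  φ y = proj₁ (forth G H d y)

  tp-φ : ∀ y → tp G ρ y ≡ tp H ρ′ (φ y)
  tp-φ y = dup⇒tp≡ G H (proj₂ (forth G H d y))

  -- Spoiler plays `y′` and `φ y`. Both answers have the type of the twinless `y`, so both are `y`,
  -- and equal answers require equal moves.
  ¬multi⇒φ : ∀ {y y′} → ¬ Multi G ρ y → tp G ρ y ≡ tp H ρ′ y′ → y′ ≡ φ y
  ¬multi⇒φ {y} {y′} ¬multi tp-y′ =
    to (link⇒≡ G H (dup⇒partialIso G H e₂ (suc zero) zero)) (trans (is-y tp-x tp-y′) (sym (is-y tp-z (tp-φ y))))
    where
    x  = proj₁ (back G H d y′)
    e₁ = proj₂ (back G H d y′)
    z  = proj₁ (back G H e₁ (φ y))
    e₂ = proj₂ (back G H e₁ (φ y))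
    tp-x = dup⇒tp≡ G H e₁
    tp-z : tp G ρ z ≡ tp H ρ′ (φ y)
    tp-z = Vec.∷-injectiveʳ (dup⇒tp≡ G H e₂)
    is-y : ∀ {w w′} → tp G ρ w ≡ tp H ρ′ w′ → tp G ρ y ≡ tp H ρ′ w′ → w ≡ y
    is-y eq eq′ = ¬multi⇒≡ G ρ ¬multi (trans eq (sym eq′))

  -- The entry of y is constantly false when y has a twin.
  ε ε′ : Fin n → Vec Bool n
  ε  u = Vec.tabulate λ y → not (does (multi? G ρ y)) ∧ does (Graph.E? G u y)
  ε′ u = Vec.tabulate λ y → not (does (multi? G ρ y)) ∧ does (Graph.E? H u (φ y))

  -- Spoiler uses the remaining round to play `y`; if `y` has no twin, its type forces the answer
  -- `φ y`.
  dup⇒ε≡ : ∀ {u u′} → Dup G H 1 (u ∷ ρ) (u′ ∷ ρ′) → ε u ≡ ε′ u′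
  dup⇒ε≡ {u} {u′} e = Vec.tabulate-cong entry
    where
    entry : ∀ y → not (does (multi? G ρ y)) ∧ does (Graph.E? G u y) ≡
                  not (does (multi? G ρ y)) ∧ does (Graph.E? H u′ (φ y))
    entry y with multi? G ρ y
    ... | yes _ = refl
    ... | no ¬multi = subst (λ y′ → does (Graph.E? G u y) ≡ does (Graph.E? H u′ y′))
      (¬multi⇒φ ¬multi (Vec.∷-injectiveʳ (dup⇒tp≡ G H e′)))
      (cong proj₂ (dup⇒partialIso G H e′ (suc zero) zero))
      where e′ = proj₂ (forth G H e y)

  ε≡⇒E⇔ : ∀ {u u′ y} → ¬ Multi G ρ y → ε u ≡ ε′ u′ → Graph.E G u y ⇔ Graph.E H u′ (φ y)
  ε≡⇒E⇔ {u} {u′} {y} ¬multi eq = does-≡⇒⇔ (Graph.E? G u y) (Graph.E? H u′ (φ y))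
    (subst (λ b → not b ∧ does (Graph.E? G u y) ≡ not b ∧ does (Graph.E? H u′ (φ y)))
      (dec-false (multi? G ρ y) ¬multi)
      (trans (sym (Vec.lookup∘tabulate _ y)) (trans (cong (λ v → lookup v y) eq) (Vec.lookup∘tabulate _ y))))

  _≟ᵇ_ : DecidableEquality (Type k × Vec Bool n)
  _≟ᵇ_ = Product.≡-dec _≟ᵗ_ (Vec.≡-dec Bool._≟_)

  δ δ′ : Fin n → Type k × Vec Bool n
  δ  u = tp G ρ u , ε u
  δ′ u = tp H ρ′ u , ε′ u

  -- Adjacency to a twinless vertex is read off `ε`. For distinct `u` and `v` with twins, Spoiler
  -- plays their images; the answers `a` and `b` have the types of `u` and `v`, so homogeneity
  -- applies.
  matching⇒≅ : ∃[ π ] (∀ u → δ u ≡ δ′ (π ⟨$⟩ʳ u)) → G ≅ H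
  matching⇒≅ (π , δ≡) = π , λ u v → by-cases u v (multi? G ρ u) (multi? G ρ v) (u Fin.≟ v)
    where
    tp≡ : ∀ u → tp G ρ u ≡ tp H ρ′ (π ⟨$⟩ʳ u)
    tp≡ = cong proj₁ ∘ δ≡

    E⇔-single : ∀ u {v} → ¬ Multi G ρ v → Graph.E G u v ⇔ Graph.E H (π ⟨$⟩ʳ u) (π ⟨$⟩ʳ v)
    E⇔-single u {v} ¬multi = subst (λ w → Graph.E G u v ⇔ Graph.E H (π ⟨$⟩ʳ u) w)
      (sym (¬multi⇒φ ¬multi (tp≡ v))) (ε≡⇒E⇔ ¬multi (cong proj₂ (δ≡ u)))

    by-cases : ∀ u v → Dec (Multi G ρ u) → Dec (Multi G ρ v) → Dec (u ≡ v) →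
      Graph.E G u v ⇔ Graph.E H (π ⟨$⟩ʳ u) (π ⟨$⟩ʳ v)
    by-cases u v _ (no ¬multi) _ = E⇔-single u ¬multi
    by-cases u v (no ¬multi) (yes _) _ = mk⇔
      (Graph.E-sym H ∘ to (E⇔-single v ¬multi) ∘ Graph.E-sym G)
      (Graph.E-sym G ∘ from (E⇔-single v ¬multi) ∘ Graph.E-sym H)
    by-cases u .u (yes _) (yes _) (yes refl) = link⇒E G H (link-refl G H u (π ⟨$⟩ʳ u))
    by-cases u v (yes mu) (yes mv) (no u≢v) = link⇒E G H
      (trans (link-homogeneous G ρ ¬imp mu mv tp-a tp-b a≢b u≢v) (dup⇒partialIso G H e₂ (suc zero) zero))
      where
      u′ = π ⟨$⟩ʳ u
      v′ = π ⟨$⟩ʳ v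
      a  = proj₁ (back G H d u′)
      e₁ = proj₂ (back G H d u′)
      b  = proj₁ (back G H e₁ v′)
      e₂ = proj₂ (back G H e₁ v′)
      tp-a = trans (dup⇒tp≡ G H e₁) (sym (tp≡ u))
      tp-b = trans (Vec.∷-injectiveʳ (dup⇒tp≡ G H e₂)) (sym (tp≡ v))
      a≢b : a ≢ b
      a≢b eq = u≢v (Injection.injective (↔⇒↣ π) (to (link⇒≡ G H (dup⇒partialIso G H e₂ (suc zero) zero)) eq))

  maximal⇒≅ : ∀ {R} → DistinctBy (tp G ρ) R → 2 * k + 1 ≤ length R → 2 + n ≤ 2 * (k + (2 + r)) → G ≅ H
  maximal⇒≅ {R} R! k≤R n≤ = by-cases (matching-or-imbalance _≟ᵇ_ δ δ′)
    where
    -- Duplicator's answers to `R` represent as many types in `H`, as the case with exchanged graphs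
    -- requires.
    R′ = List.map φ R

    R′! : DistinctBy (tp H ρ′) R′
    R′! = AllPairs.map⁺ (AllPairs.map (λ {x} {y} ≢ eq → ≢ (trans (tp-φ x) (trans eq (sym (tp-φ y))))) R!)

    k≤R′ : 2 * k + 1 ≤ length R′
    k≤R′ = subst (2 * k + 1 ≤_) (sym (List.length-map φ R)) k≤R

    by-cases : (∃[ π ] (∀ u → δ u ≡ δ′ (π ⟨$⟩ʳ u))) ⊎
      (∃[ c ] length (fibre _≟ᵇ_ δ c) < length (fibre _≟ᵇ_ δ′ c)) ×
      (∃[ c ] length (fibre _≟ᵇ_ δ′ c) < length (fibre _≟ᵇ_ δ c)) → G ≅ H
    by-cases (inj₁ matching) = matching⇒≅ matching
    by-cases (inj₂ ((c₁ , lt₁) , (c₂ , lt₂)))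
      -- The class of `c₁` is smaller in `G`, that of `c₂` in `H`. The lesser of these two sizes is
      -- also below the size of the other class in its own graph.
      with ℕ.≤-total (length (fibre _≟ᵇ_ δ c₁)) (length (fibre _≟ᵇ_ δ′ c₂))
    ... | inj₁ le = ⊥-elim (Imbalance.absurd G H (Vec.≡-dec Bool._≟_) ε ε′ dup⇒ε≡ {c₁ = c₁} {c₂}
      R! k≤R n≤ d lt₁ (ℕ.≤-<-trans le lt₂))
    ... | inj₂ ge = ⊥-elim (Imbalance.absurd H G (Vec.≡-dec Bool._≟_) ε′ ε
      (λ e → sym (dup⇒ε≡ (dup-sym H G e))) {c₁ = c₂} {c₁}
      R′! k≤R′ n≤ (dup-sym G H d) lt₂ (ℕ.≤-<-trans ge lt₁))

-- Playing improving moves, and the final bound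

2[1+a] : ∀ a → 2 * suc a + 1 ≡ 2 + (2 * a + 1)
2[1+a] = solve-∀

-- An improving move raises `k` and lowers `r` by one, so `k + r` is constant, and it adds the two
-- types that keep `2 * k + 1` a lower bound.
dup⇒≅ : ∀ (G H : Graph n) r {ρ ρ′ : Vec (Fin n) k} → Dup G H r ρ ρ′ → ∀ {R} → DistinctBy (tp G ρ) R →
  2 * k + 1 ≤ length R → 2 + n ≤ 2 * (k + r) → G ≅ H
dup⇒≅ {n} {k} G H r {ρ} {ρ′} d {R} R! k≤R n≤ = go r d n≤ (improvable? G ρ)
  where
  -- Representatives are distinct vertices, so `2 * k + 1 ≤ n`, which leaves two rounds.
  2≤ : ∀ r → 2 + n ≤ 2 * (k + r) → 2 ≤ r
  2≤ r n≤ = ℕ.+-cancelˡ-< k _ _ (ℕ.*-cancelˡ-< 2 _ _ (begin-strict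
    2 * (k + 1)             ≡⟨ ℕ.*-distribˡ-+ 2 k 1 ⟩
    2 * k + 2               <⟨ ℕ.+-monoʳ-< (2 * k) (ℕ.n<1+n 2) ⟩
    2 * k + 3               ≡⟨ ℕ.+-assoc (2 * k) 1 2 ⟨
    2 * k + 1 + 2           ≤⟨ ℕ.+-monoˡ-≤ 2 (ℕ.≤-trans k≤R (unique⇒length≤ (AllPairs.map (λ ≢ eq → ≢ (cong (tp G ρ) eq)) R!))) ⟩
    n + 2                   ≡⟨ ℕ.+-comm n 2 ⟩
    2 + n                   ≤⟨ n≤ ⟩
    2 * (k + r)             ∎))
    where open ℕ.≤-Reasoning

  go : ∀ r → Dup G H r ρ ρ′ → 2 + n ≤ 2 * (k + r) → Dec (Improvable G ρ) → G ≅ H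
  go zero          d n≤ _ = contradiction (2≤ 0 n≤) λ ()
  go (suc zero)    d n≤ _ = contradiction (2≤ 1 n≤) λ { (s≤s ()) }
  go (suc (suc r)) d n≤ (no ¬imp) = Maximal.maximal⇒≅ G H d ¬imp R! k≤R n≤
  go (suc (suc r)) d n≤ (yes (u , multi , w₁ , w₂ , split)) =
    let R′ , R′! , R<R′ = improve G ρ multi split R!
        u′ , d′ = forth G H d u
    in dup⇒≅ G H (suc r) d′ R′!
         (ℕ.≤-trans (ℕ.≤-reflexive (2[1+a] k)) (ℕ.≤-trans (s≤s (s≤s k≤R)) R<R′))
         (subst (λ l → 2 + n ≤ 2 * l) (ℕ.+-suc k (suc r)) n≤)

2⌊n/2⌋≤n : ∀ n → 2 * ⌊ n /2⌋ ≤ n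
2⌊n/2⌋≤n n = begin
  ⌊ n /2⌋ + (⌊ n /2⌋ + 0)  ≡⟨ cong (⌊ n /2⌋ +_) (ℕ.+-identityʳ _) ⟩
  ⌊ n /2⌋ + ⌊ n /2⌋        ≤⟨ ℕ.+-monoʳ-≤ ⌊ n /2⌋ (ℕ.⌊n/2⌋≤⌈n/2⌉ n) ⟩
  ⌊ n /2⌋ + ⌈ n /2⌉        ≡⟨ ℕ.⌊n/2⌋+⌈n/2⌉≡n n ⟩
  n                        ∎
  where open ℕ.≤-Reasoning

n≤2⌈n/2⌉ : ∀ n → n ≤ 2 * ⌈ n /2⌉
n≤2⌈n/2⌉ n = begin
  n                        ≡⟨ ℕ.⌊n/2⌋+⌈n/2⌉≡n n ⟨
  ⌊ n /2⌋ + ⌈ n /2⌉        ≤⟨ ℕ.+-monoˡ-≤ ⌈ n /2⌉ (ℕ.⌊n/2⌋≤⌈n/2⌉ n) ⟩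
  ⌈ n /2⌉ + ⌈ n /2⌉        ≡⟨ cong (⌈ n /2⌉ +_) (ℕ.+-identityʳ _) ⟨
  ⌈ n /2⌉ + (⌈ n /2⌉ + 0)  ∎
  where open ℕ.≤-Reasoning

-- Initially all vertices share the empty type, and one of them represents it. Order zero has no
-- representative and is treated apart.
dup⇒≅₀ : ∀ (G H : Graph n) → Dup G H ⌈ 2 + n /2⌉ [] [] → G ≅ H
dup⇒≅₀ {zero}  G H _ = Permutation.id , λ ()
dup⇒≅₀ {suc n} G H d = dup⇒≅ G H ⌈ 3 + n /2⌉ d {zero ∷ []} ([] ∷ []) (s≤s z≤n) (n≤2⌈n/2⌉ (3 + n))

theorem1p1 : ∀ (n : ℕ) (G G′ : Graph n) → ¬ (G ≅ G′) →
    ∃[ d ] ((D[ G , G′ ]≡ d) × (2 * d ≤ n + 3))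
theorem1p1 n G G′ G≇G′ =
  let d , D≡d , d≤ = ¬dup⇒D G G′ ⌈ 2 + n /2⌉ (G≇G′ ∘ dup⇒≅₀ G G′)
  in d , D≡d , (begin
    2 * d              ≤⟨ ℕ.*-monoʳ-≤ 2 d≤ ⟩
    -- By definition `⌈ 2 + n /2⌉` is `⌊ 3 + n /2⌋`.
    2 * ⌊ 3 + n /2⌋    ≤⟨ 2⌊n/2⌋≤n (3 + n) ⟩
    3 + n              ≡⟨ ℕ.+-comm 3 n ⟩
    n + 3              ∎)
  where open ℕ.≤-Reasoning
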